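{- Let $s\ge1$ be an integer, let $p$ be a prime, and let $n=p^k$ with $k\ge 2s$. Let $G=\langle p^{k-s}+1\rangle$ be the subgroup of $\mathbb{Z}_n^\times$ generated by $p^{k-s}+1$. Then the coset index function $f_G$ is a $$\left(p^k,\ (sp+p-s)p^{k-s-1},\ \bigcup_{i=0}^{s-1}\Big\{0,\ \sum_{j=0}^{i}\varphi(p^{k-j})\Big\}\right)$$ zero-difference function, where $\varphi$ is Euler's totient function.
   Context: For a subgroup $G$ of $\mathbb{Z}_n^\times$ and $r\in\mathbb{Z}_n$, the coset $rG=\{rg\mid g\in G\}$; these cosets partition $\mathbb{Z}_n$, forming a set $D_G$. The coset index function induced by $G$ is $f_G:\mathbb{Z}_n\to\mathbb{Z}_{|D_G|}$, $f_G(x)=h_G(C_x)$, where $C_x$ is the coset containing $x$ and $h_G:D_G\to\mathbb{Z}_{|D_G|}$ is a fixed bijection. A function $f:A\to B$ between finite abelian groups is an $(n,m,S)$ zero-difference function if $n=|A|$, $m=|f(A)|$, and for every nonzero $a\in A$, $|\{x\in A\mid f(x+a)=f(x)\}|\in S$. Here $A=(\mathbb{Z}_n,+)$. -}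

module Defs where

open import Algebra.Bundles using (AbelianGroup; CommutativeRing)
open import Data.Bool.Properties as Bool using ()
open import Data.Fin using (Fin; toℕ)
open import Data.Fin.Properties as Fin using (toℕ-injective; toℕ-fromℕ<; toℕ<n; all?; any?)
open import Data.Fin.Subset using (Subset; ∣_∣) renaming (_∈_ to _∈ₛ_)
open import Data.Fin.Subset.Properties using (_∈?_; anySubset?)
open import Data.List using (allFin; deduplicate; length; map)
open import Data.Nat
open import Data.Nat.Coprimality using (coprime?)
open import Data.Nat.DivMod
open import Data.Nat.Primality using (Prime; prime⇒nonZero)
open import Data.Nat.Properties
open import Data.Nat.Solver using (module +-*-Solver)
open import Data.Product using (∃; ∃-syntax; _,_; proj₁; proj₂)
open import Data.Vec using (tabulate)
open import Data.Vec.Properties as Vec using (lookup∘tabulate; []=⇒lookup; lookup⇒[]=)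
open import Function.Bundles using (Bijection; Func; Inverse)
open import Function.Construct.Identity as Id using ()
open import Level using (Level; 0ℓ) renaming (suc to lsuc; _⊔_ to _⊔ˡ_)
open import Relation.Binary.Bundles using (Setoid)
open import Relation.Binary.Construct.On as On using ()
open import Relation.Binary.PropositionalEquality as ≡ using (_≡_; refl; sym; trans; cong; cong₂)
open import Relation.Nullary using (¬_; Dec; does; yes; no; ¬?)
open import Relation.Nullary.Decidable using (map′; decidable-stable; _×-dec_; _→-dec_; dec-true)
open import Relation.Unary using (Pred; Decidable; _∈_)

private variable
  c₁ c₂ ℓ ℓ₁ ℓ₂ : Level
  n : ℕ

-- The subset { i | P i } of Fin n.
⟦_⟧ : {P : Pred (Fin n) ℓ} → Decidable P → Subset n
⟦ P? ⟧ = tabulate (λ i → does (P? i))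

module _ {P : Pred (Fin n) ℓ} (P? : Decidable P) where

  ∈⟦⟧⁺ : ∀ {i} → P i → i ∈ₛ ⟦ P? ⟧
  ∈⟦⟧⁺ {i} Pi = lookup⇒[]= i ⟦ P? ⟧
    (trans (lookup∘tabulate (λ j → does (P? j)) i) (dec-true (P? i) Pi))

  ∈⟦⟧⁻ : ∀ {i} → i ∈ₛ ⟦ P? ⟧ → P i
  ∈⟦⟧⁻ {i} i∈ with P? i | trans (sym (lookup∘tabulate (λ j → does (P? j)) i)) ([]=⇒lookup i∈)
  ... | yes Pi | _  = Pi
  ... | no _   | ()

allSubset? : {P : Pred (Subset n) ℓ} → Decidable P → Dec (∀ H → P H)
allSubset? P? = map′
  (λ ∄ H → decidable-stable (P? H) (λ ¬PH → ∄ (H , ¬PH)))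
  (λ ∀P (H , ¬PH) → ¬PH (∀P H))
  (¬? (anySubset? (λ H → ¬? (P? H))))

-- Euler's totient: the number of 1 ≤ i ≤ n coprime to n.
φ : ℕ → ℕ
φ n = ∣ ⟦ (λ (i : Fin n) → coprime? (suc (toℕ i)) n) ⟧ ∣

record FiniteAbelianGroup c ℓ : Set (lsuc (c ⊔ˡ ℓ)) where
  field
    abelianGroup : AbelianGroup c ℓ

  open AbelianGroup abelianGroup public

  field
    order       : ℕ
    enumeration : Inverse (≡.setoid (Fin order)) setoid

  open Inverse enumeration public using ()
    renaming (to to element; from to index; from-cong to index-cong;
              strictlyInverseˡ to element-index)

  _≈?_ : ∀ x y → Dec (x ≈ y)
  x ≈? y = map′
    (λ eq → AbelianGroup.trans abelianGroup
              (AbelianGroup.sym abelianGroup (element-index x))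
              (AbelianGroup.trans abelianGroup
                (AbelianGroup.reflexive abelianGroup (cong element eq))
                (element-index y)))
    index-cong
    (index x Fin.≟ index y)

module _ (A : FiniteAbelianGroup c₁ ℓ₁) (B : FiniteAbelianGroup c₂ ℓ₂) where

  private
    module A = FiniteAbelianGroup A
    module B = FiniteAbelianGroup B

  -- Subsets of A and B are counted through the enumerations of A and B.
  module _ (f : Func A.setoid B.setoid) where
    open Func f using (to)

    image : Subset B.order
    image = ⟦ (λ j → any? (λ i → to (A.element i) B.≈? B.element j)) ⟧

    zeroDifferences : A.Carrier → Subset A.order
    zeroDifferences a =
      ⟦ (λ i → to (A.element i A.∙ a) B.≈? to (A.element i)) ⟧

  record IsZeroDifference (n m : ℕ) (S : Pred ℕ 0ℓ) (f : Func A.setoid B.setoid)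
         : Set (c₁ ⊔ˡ ℓ₁) where
    field
      domain-size     : A.order ≡ n
      image-size      : ∣ image f ∣ ≡ m
      zero-difference : ∀ a → ¬ (a A.≈ A.ε) → ∣ zeroDifferences f a ∣ ∈ S

module ℤMod (n : ℕ) .{{_ : NonZero n}} where

  ℤₙ : Set
  ℤₙ = Fin n

  infixl 6 _+ₙ_
  infixl 7 _*ₙ_

  _+ₙ_ _*ₙ_ : ℤₙ → ℤₙ → ℤₙ
  x +ₙ y = (toℕ x + toℕ y) mod n
  x *ₙ y = (toℕ x * toℕ y) mod n

  -ₙ_ : ℤₙ → ℤₙ
  -ₙ x = (n ∸ toℕ x) mod n

  [_] : ℕ → ℤₙ
  [ a ] = a mod n

  0ₙ 1ₙ : ℤₙ
  0ₙ = [ 0 ]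
  1ₙ = [ 1 ]

  private
    toℕ-mod : ∀ a → toℕ (a mod n) ≡ a % n
    toℕ-mod a = toℕ-fromℕ< (m%n<n a n)

  mod-cong : ∀ {a b} → a % n ≡ b % n → a mod n ≡ b mod n
  mod-cong {a} {b} eq = toℕ-injective (trans (toℕ-mod a) (trans eq (sym (toℕ-mod b))))

  private
    rep : ∀ x → toℕ x mod n ≡ x
    rep x = toℕ-injective (trans (toℕ-mod (toℕ x)) (m<n⇒m%n≡m (toℕ<n x)))

  mod-+ : ∀ a b → (a mod n) +ₙ (b mod n) ≡ (a + b) mod n
  mod-+ a b = mod-cong (trans
    (cong₂ (λ u v → (u + v) % n) (toℕ-mod a) (toℕ-mod b))
    (sym (%-distribˡ-+ a b n)))

  mod-* : ∀ a b → (a mod n) *ₙ (b mod n) ≡ (a * b) mod n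
  mod-* a b = mod-cong (trans
    (cong₂ (λ u v → (u * v) % n) (toℕ-mod a) (toℕ-mod b))
    (sym (%-distribˡ-* a b n)))

  private
    +-homʳ : ∀ x b → x +ₙ (b mod n) ≡ (toℕ x + b) mod n
    +-homʳ x b = trans (cong (_+ₙ (b mod n)) (sym (rep x))) (mod-+ (toℕ x) b)

    +-homˡ : ∀ a y → (a mod n) +ₙ y ≡ (a + toℕ y) mod n
    +-homˡ a y = trans (cong ((a mod n) +ₙ_) (sym (rep y))) (mod-+ a (toℕ y))

    *-homʳ : ∀ x b → x *ₙ (b mod n) ≡ (toℕ x * b) mod n
    *-homʳ x b = trans (cong (_*ₙ (b mod n)) (sym (rep x))) (mod-* (toℕ x) b)

    *-homˡ : ∀ a y → (a mod n) *ₙ y ≡ (a * toℕ y) mod n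
    *-homˡ a y = trans (cong ((a mod n) *ₙ_) (sym (rep y))) (mod-* a (toℕ y))

    +-assocₙ : ∀ x y z → (x +ₙ y) +ₙ z ≡ x +ₙ (y +ₙ z)
    +-assocₙ x y z = trans (+-homˡ _ z) (trans
      (cong (_mod n) (+-assoc (toℕ x) (toℕ y) (toℕ z))) (sym (+-homʳ x _)))

    +-commₙ : ∀ x y → x +ₙ y ≡ y +ₙ x
    +-commₙ x y = cong (_mod n) (+-comm (toℕ x) (toℕ y))

    +-identityˡₙ : ∀ x → 0ₙ +ₙ x ≡ x
    +-identityˡₙ x = trans (+-homˡ 0 x) (rep x)

    +-inverseʳₙ : ∀ x → x +ₙ (-ₙ x) ≡ 0ₙ
    +-inverseʳₙ x = trans (+-homʳ x _) (trans
      (cong (_mod n) (m+[n∸m]≡n (<⇒≤ (toℕ<n x))))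
      (mod-cong (trans (n%n≡0 n) (sym (m*n%n≡0 0 n)))))

    *-assocₙ : ∀ x y z → (x *ₙ y) *ₙ z ≡ x *ₙ (y *ₙ z)
    *-assocₙ x y z = trans (*-homˡ _ z) (trans
      (cong (_mod n) (*-assoc (toℕ x) (toℕ y) (toℕ z))) (sym (*-homʳ x _)))

    *-commₙ : ∀ x y → x *ₙ y ≡ y *ₙ x
    *-commₙ x y = cong (_mod n) (*-comm (toℕ x) (toℕ y))

    *-identityˡₙ : ∀ x → 1ₙ *ₙ x ≡ x
    *-identityˡₙ x = trans (*-homˡ 1 x) (trans (cong (_mod n) (*-identityˡ (toℕ x))) (rep x))

    *-distribˡₙ : ∀ x y z → x *ₙ (y +ₙ z) ≡ (x *ₙ y) +ₙ (x *ₙ z)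
    *-distribˡₙ x y z = trans (*-homʳ x _) (trans
      (cong (_mod n) (*-distribˡ-+ (toℕ x) (toℕ y) (toℕ z))) (sym (mod-+ _ _)))

    *-distribʳₙ : ∀ x y z → (y +ₙ z) *ₙ x ≡ (y *ₙ x) +ₙ (z *ₙ x)
    *-distribʳₙ x y z = trans (*-homˡ _ x) (trans
      (cong (_mod n) (*-distribʳ-+ (toℕ x) (toℕ y) (toℕ z))) (sym (mod-+ _ _)))

  commutativeRing : CommutativeRing 0ℓ 0ℓ
  commutativeRing = record
    { Carrier = ℤₙ ; _≈_ = _≡_
    ; _+_ = _+ₙ_ ; _*_ = _*ₙ_ ; -_ = -ₙ_ ; 0# = 0ₙ ; 1# = 1ₙ
    ; isCommutativeRing = record
      { isRing = record
        { +-isAbelianGroup = record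
          { isGroup = record
            { isMonoid = record
              { isSemigroup = record
                { isMagma = record { isEquivalence = ≡.isEquivalence ; ∙-cong = cong₂ _+ₙ_ }
                ; assoc = +-assocₙ }
              ; identity = +-identityˡₙ , (λ x → trans (+-commₙ x 0ₙ) (+-identityˡₙ x)) }
            ; inverse = (λ x → trans (+-commₙ (-ₙ x) x) (+-inverseʳₙ x)) , +-inverseʳₙ
            ; ⁻¹-cong = cong -ₙ_ }
          ; comm = +-commₙ }
        ; *-cong = cong₂ _*ₙ_
        ; *-assoc = *-assocₙ
        ; *-identity = *-identityˡₙ , (λ x → trans (*-commₙ x 1ₙ) (*-identityˡₙ x))
        ; distrib = *-distribˡₙ , *-distribʳₙ }
      ; *-comm = *-commₙ } }

  additiveGroup : FiniteAbelianGroup 0ℓ 0ℓ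
  additiveGroup = record
    { abelianGroup = CommutativeRing.+-abelianGroup commutativeRing
    ; order        = n
    ; enumeration  = Id.inverse (≡.setoid ℤₙ)
    }

  IsUnit : Pred ℤₙ 0ℓ
  IsUnit x = ∃[ y ] x *ₙ y ≡ 1ₙ

  ℤₙˣ : Set
  ℤₙˣ = ∃ IsUnit

  record IsUnitSubgroup (H : Subset n) : Set where
    field
      units     : ∀ x → x ∈ₛ H → IsUnit x
      1-closed  : 1ₙ ∈ₛ H
      *-closed  : ∀ x → x ∈ₛ H → ∀ y → y ∈ₛ H → x *ₙ y ∈ₛ H
      ⁻¹-closed : ∀ x → x ∈ₛ H → ∀ y → x *ₙ y ≡ 1ₙ → y ∈ₛ H

  isUnit? : Decidable IsUnit
  isUnit? x = any? (λ y → x *ₙ y Fin.≟ 1ₙ)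

  isUnitSubgroup? : Decidable IsUnitSubgroup
  isUnitSubgroup? H = map′
    (λ (u , o , m , i) → record { units = u ; 1-closed = o ; *-closed = m ; ⁻¹-closed = i })
    (λ H-sub → let open IsUnitSubgroup H-sub in units , 1-closed , *-closed , ⁻¹-closed)
    (all? (λ x → (x ∈? H) →-dec isUnit? x)
     ×-dec (1ₙ ∈? H)
     ×-dec all? (λ x → (x ∈? H) →-dec all? (λ y → (y ∈? H) →-dec (x *ₙ y ∈? H)))
     ×-dec all? (λ x → (x ∈? H) →-dec all? (λ y → (x *ₙ y Fin.≟ 1ₙ) →-dec (y ∈? H))))

  record UnitSubgroup : Set where
    field
      elements       : Subset n
      isUnitSubgroup : IsUnitSubgroup elements

  private
    allUnits : IsUnitSubgroup ⟦ isUnit? ⟧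
    allUnits = record
      { units     = λ _ → ∈⟦⟧⁻ isUnit?
      ; 1-closed  = ∈⟦⟧⁺ isUnit? (1ₙ , *-identityˡₙ 1ₙ)
      ; *-closed  = λ x x∈ y y∈ → let (x′ , xx′) = ∈⟦⟧⁻ isUnit? x∈
                                      (y′ , yy′) = ∈⟦⟧⁻ isUnit? y∈
                    in ∈⟦⟧⁺ isUnit? (y′ *ₙ x′ , prod x y x′ y′ xx′ yy′)
      ; ⁻¹-closed = λ x _ y xy → ∈⟦⟧⁺ isUnit? (x , trans (*-commₙ y x) xy)
      }
      where
      prod : ∀ x y x′ y′ → x *ₙ x′ ≡ 1ₙ → y *ₙ y′ ≡ 1ₙ → (x *ₙ y) *ₙ (y′ *ₙ x′) ≡ 1ₙ
      prod x y x′ y′ xx′ yy′ = begin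
        (x *ₙ y) *ₙ (y′ *ₙ x′)  ≡⟨ *-assocₙ x y (y′ *ₙ x′) ⟩
        x *ₙ (y *ₙ (y′ *ₙ x′))  ≡⟨ cong (x *ₙ_) (*-assocₙ y y′ x′) ⟨
        x *ₙ ((y *ₙ y′) *ₙ x′)  ≡⟨ cong (λ z → x *ₙ (z *ₙ x′)) yy′ ⟩
        x *ₙ (1ₙ *ₙ x′)         ≡⟨ cong (x *ₙ_) (*-identityˡₙ x′) ⟩
        x *ₙ x′                 ≡⟨ xx′ ⟩
        1ₙ                      ∎
        where open ≡.≡-Reasoning

  InGenerated : ℤₙˣ → Pred ℤₙ 0ℓ
  InGenerated (u , _) x = ∀ H → IsUnitSubgroup H → u ∈ₛ H → x ∈ₛ H

  inGenerated? : ∀ u → Decidable (InGenerated u)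
  inGenerated? (u , _) x =
    allSubset? (λ H → isUnitSubgroup? H →-dec ((u ∈? H) →-dec (x ∈? H)))

  -- The least subgroup of ℤₙˣ containing u.
  ⟨_⟩ : ℤₙˣ → UnitSubgroup
  ⟨ u ⟩ = record
    { elements       = ⟦ inGenerated? u ⟧
    ; isUnitSubgroup = record
      { units     = λ x x∈ → ∈⟦⟧⁻ isUnit? (out x∈ _ allUnits (∈⟦⟧⁺ isUnit? (proj₂ u)))
      ; 1-closed  = ∈⟦⟧⁺ (inGenerated? u) (λ H sub u∈ → IsUnitSubgroup.1-closed sub)
      ; *-closed  = λ x x∈ y y∈ → ∈⟦⟧⁺ (inGenerated? u) (λ H sub u∈ →
                      IsUnitSubgroup.*-closed sub x (out x∈ H sub u∈) y (out y∈ H sub u∈))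
      ; ⁻¹-closed = λ x x∈ y xy → ∈⟦⟧⁺ (inGenerated? u) (λ H sub u∈ →
                      IsUnitSubgroup.⁻¹-closed sub x (out x∈ H sub u∈) y xy)
      }
    }
    where
    out : ∀ {x} → x ∈ₛ ⟦ inGenerated? u ⟧ → InGenerated u x
    out = ∈⟦⟧⁻ (inGenerated? u)

  module _ (G : UnitSubgroup) where
    open UnitSubgroup G

    -- r G = { r g | g ∈ G }
    coset : ℤₙ → Subset n
    coset r = ⟦ (λ x → any? (λ g → (g ∈? elements) ×-dec (x Fin.≟ r *ₙ g))) ⟧

    -- The set of cosets: subsets of ℤₙ of the form r G, compared as subsets
    -- (the choice of r is ignored).
    D : Setoid 0ℓ 0ℓ
    D = On.setoid {B = ∃[ C ] ∃[ r ] C ≡ coset r} (≡.setoid (Subset n)) proj₁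

    -- The number of distinct subsets among the r G.
    ∣D∣ : ℕ
    ∣D∣ = length (deduplicate (Vec.≡-dec Bool._≟_) (map coset (allFin n)))

    -- As 1 ∈ G, the coset containing x is x G.
    cosetOf : ℤₙ → Setoid.Carrier D
    cosetOf x = coset x , x , refl

    cosetIndex : Bijection D (≡.setoid (Fin ∣D∣)) → Func (≡.setoid ℤₙ) (≡.setoid (Fin ∣D∣))
    cosetIndex h = record
      { to   = λ x → Bijection.to h (cosetOf x)
      ; cong = cong (λ x → Bijection.to h (cosetOf x))
      }

∣D∣-nonZero : ∀ n .{{_ : NonZero n}} (G : ℤMod.UnitSubgroup n) → NonZero (ℤMod.∣D∣ n G)
∣D∣-nonZero (suc _) _ = _

ℤ/ : ∀ n → .(NonZero n) → FiniteAbelianGroup 0ℓ 0ℓ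
ℤ/ n n≢0 = ℤMod.additiveGroup n {{n≢0}}

prime^-nonZero : ∀ {p} → Prime p → ∀ k → NonZero (p ^ k)
prime^-nonZero {p} pr k = m^n≢0 p k {{prime⇒nonZero pr}}

module _ (s p k : ℕ) (pr : Prime p) (k≥2s : k ≥ 2 * s) where

  private
    instance
      p^k-nonZero : NonZero (p ^ k)
      p^k-nonZero = prime^-nonZero pr k

    q N : ℕ
    q = p ^ (k ∸ s)
    N = p ^ k

    exponents : (k ∸ s) + (k ∸ s) ≡ (k ∸ 2 * s) + k
    exponents = aux (k ∸ 2 * s) (m+[n∸m]≡n k≥2s)
      where
      open +-*-Solver
      aux : ∀ d → 2 * s + d ≡ k → (k ∸ s) + (k ∸ s) ≡ d + k
      aux d refl = trans (cong (λ t → t + t) k∸s)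
        (solve 2 (λ s d → (s :+ d) :+ (s :+ d) := d :+ (con 2 :* s :+ d)) refl s d)
        where
        k∸s : 2 * s + d ∸ s ≡ s + d
        k∸s = trans (cong (_∸ s)
          (solve 2 (λ s d → con 2 :* s :+ d := s :+ (s :+ d)) refl s d)) (m+n∸m≡n s (s + d))

    q² : q * q ≡ p ^ (k ∸ 2 * s) * N
    q² = trans (sym (^-distribˡ-+-* p (k ∸ s) (k ∸ s)))
      (trans (cong (p ^_) exponents) (^-distribˡ-+-* p (k ∸ 2 * s) k))

  open ℤMod (p ^ k)

  -- Since q = p ^ (k ∸ s) satisfies q² ≡ 0, an inverse of q + 1 is 1 - q,
  -- written with natural numbers as 1 + q (p ^ k - 1).
  p^[k∸s]+1-isUnit : IsUnit [ p ^ (k ∸ s) + 1 ]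
  p^[k∸s]+1-isUnit = [ 1 + q * pred N ] , trans (mod-* (q + 1) (1 + q * pred N))
    (mod-cong (trans (cong (_% N) expand) ([m+kn]%n≡m%n 1 (q + e * pred N) N)))
    where
    open +-*-Solver
    e = p ^ (k ∸ 2 * s)
    expand : (q + 1) * (1 + q * pred N) ≡ 1 + (q + e * pred N) * N
    expand = begin
      (q + 1) * (1 + q * pred N)
        ≡⟨ solve 2 (λ q m → (q :+ con 1) :* (con 1 :+ q :* m)
             := con 1 :+ q :* (con 1 :+ m) :+ q :* q :* m) refl q (pred N) ⟩
      1 + q * suc (pred N) + q * q * pred N
        ≡⟨ cong₂ (λ a b → 1 + q * a + b * pred N) (suc-pred N) q² ⟩
      1 + q * N + e * N * pred N
        ≡⟨ solve 4 (λ q n e m → con 1 :+ q :* n :+ e :* n :* m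
             := con 1 :+ (q :+ e :* m) :* n) refl q N e (pred N) ⟩
      1 + (q + e * pred N) * N ∎
      where open ≡.≡-Reasoning

{-# OPTIONS --safe #-}

-- Put q = p^(k-s).  Since p^k divides q², the group G is { 1 + t q }, so y ∈ x G
-- iff y ≡ x + x t q for some t.  For x prime to p this says y ≡ x modulo q; for
-- x = p x′ it says y = p y′ with y′ related to x′ modulo p^(k-1), with s lowered
-- by one.  Hence there are s (q - q/p) + q cosets.  For a nonzero a, x + a lies in
-- x G only if a = q b, and then, when p^i exactly divides b (so i < s), iff
-- p^(i+1) does not divide x; this holds for p^k - p^(k-i-1) residues x, which is
-- the telescoped sum of totients.
module Submission where

open import Defs
import Data.Bool.Properties as Bool
open import Data.Fin as Fin using (Fin; toℕ; fromℕ<)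
import Data.Fin.Properties as Fin
open import Data.Fin.Properties using (any?)
open import Data.Fin.Subset using (∣_∣) renaming (_∈_ to _∈ₛ_)
open import Data.Fin.Subset.Properties using (⊆-antisym; ∣∁p∣≡n∸∣p∣; x∈∁p⇒x∉p; x∉p⇒x∈∁p; _∈?_)
open import Data.List using (List; []; _∷_; _++_; allFin; applyUpTo; cartesianProductWith; deduplicate; filter; length; map; upTo)
import Data.List as List
import Data.List.Properties as List
open import Data.List.Membership.Propositional using (_∈_)
open import Data.List.Membership.Propositional.Properties
open import Data.List.Membership.Propositional.Properties.WithK using (unique∧set⇒bag)
open import Data.List.Relation.Binary.BagAndSetEquality using (∼bag⇒↭)
open import Data.List.Relation.Binary.Permutation.Propositional.Properties using (↭-length)
open import Data.List.Relation.Unary.All as All using ()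
import Data.List.Relation.Unary.All.Properties as All
open import Data.List.Relation.Unary.AllPairs using ([]; _∷_)
open import Data.List.Relation.Unary.Any using (here; there)
open import Data.List.Relation.Unary.Unique.Propositional using (Unique)
open import Data.List.Relation.Unary.Unique.DecPropositional.Properties using (deduplicate-!)
import Data.List.Relation.Unary.Unique.Propositional.Properties as Unique
open import Data.Nat using (ℕ; zero; suc; pred; _+_; _*_; _∸_; _^_; _≤_; _<_; _≥_; z≤n; s≤s; NonZero; ≢-nonZero)
open import Data.Nat.Coprimality using (Coprime; coprime-Bézout; coprime-divisor; coprime?)
open import Data.Nat.Divisibility
open import Data.Nat.DivMod
open import Data.Nat.GCD using (module Bézout)
open import Data.Nat.ListAction using (sum)
open import Data.Nat.Primality using (Prime; prime⇒nonZero; prime⇒irreducible; ¬prime[0]; ¬prime[1])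
open import Data.Nat.Properties
open import Data.Nat.Tactic.RingSolver using (solve-∀)
open import Data.Product using (∃₂; ∃-syntax; _×_; _,_; proj₁; proj₂)
open import Data.Sum using (_⊎_; inj₁; inj₂)
import Data.Vec.Properties as Vec
open import Function using (_∘_; id; _⇔_; mk⇔; Equivalence)
open import Function.Bundles using (Bijection)
open import Level using (Level; 0ℓ)
open import Relation.Binary.PropositionalEquality using (_≡_; _≢_; refl; sym; trans; cong; cong₂; subst; subst₂; setoid; module ≡-Reasoning)
open import Relation.Nullary using (¬_; Dec; yes; no; contradiction)
open import Relation.Nullary.Decidable using (map′; _×-dec_)
open import Relation.Unary using (Pred; Decidable; ⋃; _∪_; ｛_｝) renaming (_∈_ to _∈ᵤ_)

private variable
  a ℓ : Level
  A B C : Set a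
  d m n p q u v w x y z N P : ℕ

-- Congruence of natural numbers.

infix 4 _≋_[mod_]

-- Both sides are raised by multiples of N, so that no subtraction occurs.
record _≋_[mod_] (x y N : ℕ) : Set where
  constructor balance
  field
    {left right} : ℕ
    balanced     : x + left * N ≡ y + right * N

≋-refl : x ≋ x [mod N ]
≋-refl {x} {N} = balance {left = 0} {right = 0} (refl {x = x + 0 * N})

≋-reflexive : x ≡ y → x ≋ y [mod N ]
≋-reflexive refl = ≋-refl

≋-sym : x ≋ y [mod N ] → y ≋ x [mod N ]
≋-sym (balance {u} {v} eq) = balance {left = v} {right = u} (sym eq)

≋-trans : x ≋ y [mod N ] → y ≋ z [mod N ] → x ≋ z [mod N ]
≋-trans {x} {y} {N} {z} (balance {u} {v} eq) (balance {u′} {v′} eq′) =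
  balance {left = u + u′} {right = v + v′} (begin
    x + (u + u′) * N      ≡⟨ distribute x u u′ N ⟩
    (x + u * N) + u′ * N  ≡⟨ cong (_+ u′ * N) eq ⟩
    (y + v * N) + u′ * N  ≡⟨ exchange y v u′ N ⟩
    (y + u′ * N) + v * N  ≡⟨ cong (_+ v * N) eq′ ⟩
    (z + v′ * N) + v * N  ≡⟨ exchange z v′ v N ⟩
    (z + v * N) + v′ * N  ≡⟨ distribute z v v′ N ⟨
    z + (v + v′) * N      ∎)
  where
  open ≡-Reasoning
  distribute : ∀ x u u′ N → x + (u + u′) * N ≡ (x + u * N) + u′ * N
  distribute = solve-∀
  exchange : ∀ y v u′ N → (y + v * N) + u′ * N ≡ (y + u′ * N) + v * N
  exchange = solve-∀

≋-+ˡ : ∀ c → x ≋ y [mod N ] → c + x ≋ c + y [mod N ]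
≋-+ˡ {x} {y} {N} c (balance {u} {v} eq) = balance {left = u} {right = v}
  (trans (+-assoc c x _) (trans (cong (c +_) eq) (sym (+-assoc c y _))))

≋-cancel-+ˡ : ∀ c → c + x ≋ c + y [mod N ] → x ≋ y [mod N ]
≋-cancel-+ˡ {x} {y} {N} c (balance {u} {v} eq) = balance {left = u} {right = v}
  (+-cancelˡ-≡ c _ _ (trans (sym (+-assoc c x _)) (trans eq (+-assoc c y _))))

≋-*ˡ : ∀ c → x ≋ y [mod N ] → c * x ≋ c * y [mod N ]
≋-*ˡ {x} {y} {N} c (balance {u} {v} eq) = balance {left = c * u} {right = c * v}
  (trans (expand c x u N) (trans (cong (c *_) eq) (sym (expand c y v N))))
  where
  expand : ∀ c x u N → c * x + c * u * N ≡ c * (x + u * N)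
  expand = solve-∀

≋-* : x ≋ y [mod N ] → u ≋ v [mod N ] → x * u ≋ y * v [mod N ]
≋-* {x} {y} {N} {u} {v} x≋y u≋v = ≋-trans (≋-*ˡ x u≋v)
  (subst₂ (_≋_[mod N ]) (*-comm v x) (*-comm v y) (≋-*ˡ v x≋y))

≋-scale : ∀ c → x ≋ y [mod N ] → c * x ≋ c * y [mod c * N ]
≋-scale {x} {y} {N} c (balance {u} {v} eq) = balance {left = u} {right = v}
  (trans (expand c x u N) (trans (cong (c *_) eq) (sym (expand c y v N))))
  where
  expand : ∀ c x u N → c * x + u * (c * N) ≡ c * (x + u * N)
  expand = solve-∀

≋-unscale : ∀ c .{{_ : NonZero c}} → c * x ≋ c * y [mod c * N ] → x ≋ y [mod N ]
≋-unscale {x} {y} {N} c (balance {u} {v} eq) = balance {left = u} {right = v}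
  (*-cancelˡ-≡ _ _ c (trans (sym (expand c x u N)) (trans eq (expand c y v N))))
  where
  expand : ∀ c x u N → c * x + u * (c * N) ≡ c * (x + u * N)
  expand = solve-∀

≋-coarsen : d ∣ N → x ≋ y [mod N ] → x ≋ y [mod d ]
≋-coarsen {d} {x = x} {y = y} (divides-refl f) (balance {u} {v} eq) =
  balance {left = u * f} {right = v * f}
    (subst₂ (λ α β → x + α ≡ y + β) (sym (*-assoc u f d)) (sym (*-assoc v f d)) eq)

≋-resp-∣ : d ∣ N → x ≋ y [mod N ] → d ∣ x → d ∣ y
≋-resp-∣ {d} {N} {x} {y} d∣N (balance {u} {v} eq) d∣x = ∣m+n∣m⇒∣n
  (subst (d ∣_) (trans eq (+-comm y (v * N))) (∣m∣n⇒∣m+n d∣x (∣n⇒∣m*n u d∣N)))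
  (∣n⇒∣m*n v d∣N)

module _ {N : ℕ} .{{_ : NonZero N}} where

  %≋ : ∀ x → x % N ≋ x [mod N ]
  %≋ x = balance {left = x / N} {right = 0} (trans (sym (m≡m%n+[m/n]*n x N)) (sym (+-identityʳ x)))

  ≋⇒%≡ : x ≋ y [mod N ] → x % N ≡ y % N
  ≋⇒%≡ {x} {y} (balance {u} {v} eq) = begin
    x % N            ≡⟨ [m+kn]%n≡m%n x u N ⟨
    (x + u * N) % N  ≡⟨ cong (_% N) eq ⟩
    (y + v * N) % N  ≡⟨ [m+kn]%n≡m%n y v N ⟩
    y % N            ∎
    where open ≡-Reasoning

  %≡⇒≋ : x % N ≡ y % N → x ≋ y [mod N ]
  %≡⇒≋ {x} {y} eq = ≋-trans (≋-sym (%≋ x)) (subst (_≋ y [mod N ]) (sym eq) (%≋ y))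

  ≋? : ∀ x y → Dec (x ≋ y [mod N ])
  ≋? x y = map′ %≡⇒≋ ≋⇒%≡ (x % N ≟ y % N)

  ≋⇒≡ : x < N → y < N → x ≋ y [mod N ] → x ≡ y
  ≋⇒≡ x<N y<N x≋y = trans (sym (m<n⇒m%n≡m x<N)) (trans (≋⇒%≡ x≋y) (m<n⇒m%n≡m y<N))

-- Here `x - y` is `(v - u) * q`, which may be negative. Modulo `q * P` the coefficient only matters
-- modulo `P`, so `- u` is replaced by `u * (P - 1)`, which keeps `t` a natural number.
≋-refine : ∀ P .{{_ : NonZero P}} → x ≋ y [mod q ] → ∃[ t ] x ≋ y + t * q [mod q * P ]
≋-refine {x} {y} {q} (suc P) (balance {u} {v} eq) =
  v + u * P , balance {left = u} {right = 0} (begin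
    x + u * (q * suc P)                ≡⟨ expand x u q P ⟩
    (x + u * q) + u * P * q            ≡⟨ cong (_+ u * P * q) eq ⟩
    (y + v * q) + u * P * q            ≡⟨ collect y v q u P ⟩
    y + (v + u * P) * q + 0            ∎)
  where
  open ≡-Reasoning
  expand : ∀ x u q P → x + u * (q * suc P) ≡ (x + u * q) + u * P * q
  expand = solve-∀
  collect : ∀ y v q u P → (y + v * q) + u * P * q ≡ y + (v + u * P) * q + 0
  collect = solve-∀

-- Units modulo a prime power, and valuations.

coprime⇒invertible : ∀ x P .{{_ : NonZero P}} → Coprime x P → ∃[ x⁻¹ ] x * x⁻¹ ≋ 1 [mod P ]
coprime⇒invertible x P@(suc P-1) c with coprime-Bézout c
... | Bézout.+- u v eq = u , balance {left = 0} {right = v}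
  (trans (+-identityʳ _) (trans (*-comm x u) (sym eq)))
-- In this case `1 + u * x = v * P`, so the inverse is `- u`, written as `u * (P - 1)`.
... | Bézout.-+ u v eq = u * P-1 , balance {left = v} {right = u * x} (begin
    x * (u * P-1) + v * P              ≡⟨ cong (x * (u * P-1) +_) eq ⟨
    x * (u * P-1) + (1 + u * x)        ≡⟨ collect x u P-1 ⟩
    1 + u * x * P                      ∎)
  where
  open ≡-Reasoning
  collect : ∀ x u m → x * (u * m) + (1 + u * x) ≡ 1 + u * x * suc m
  collect = solve-∀

-- A common divisor `d` divides `x` and is therefore coprime to `p`, so the factors `p` of `p ^ e`
-- can be struck off one at a time until `d` divides `1`.
∤⇒coprime-^ : Prime p → ¬ p ∣ x → ∀ e → Coprime x (p ^ e)
∤⇒coprime-^ pr p∤x zero (_ , d∣1) = ∣1⇒≡1 d∣1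
∤⇒coprime-^ {p} pr p∤x (suc e) {d} (d∣x , d∣p*p^e) =
  ∤⇒coprime-^ pr p∤x e (d∣x , coprime-divisor d⊥p d∣p*p^e)
  where
  d⊥p : Coprime d p
  d⊥p (c∣d , c∣p) with prime⇒irreducible pr c∣p
  ... | inj₁ c≡1  = c≡1
  ... | inj₂ refl = contradiction (∣-trans c∣d d∣x) p∤x

^-monoʳ-∣ : ∀ p → m ≤ n → p ^ m ∣ p ^ n
^-monoʳ-∣ {m} {n} p m≤n = divides (p ^ (n ∸ m))
  (trans (cong (p ^_) (sym (m∸n+n≡m m≤n))) (^-distribˡ-+-* p (n ∸ m) m))

-- The hypothesis excludes `x = 0`, and `n` bounds the number of divisions by `p`. The bound `j < n`
-- matters later: it yields `i < s` for shifts and `j ≤ i` for the elements being shifted.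
valuation : ∀ p .{{_ : NonZero p}} n → ¬ p ^ n ∣ x →
            ∃₂ λ j u → j < n × x ≡ p ^ j * u × ¬ p ∣ u
valuation p zero p^0∤x = contradiction (1∣ _) p^0∤x
valuation {x} p (suc n) p^1+n∤x with p ∣? x
... | no p∤x = 0 , x , s≤s z≤n , sym (*-identityˡ x) , p∤x
... | yes (divides c refl) with valuation {c} p n (λ p^n∣c → p^1+n∤x (subst (_∣ c * p) (*-comm (p ^ n) p) (*-monoˡ-∣ p p^n∣c)))
... | j , u , j<n , refl , p∤u = suc j , u , s≤s j<n , shift p (p ^ j) u , p∤u
  where
  shift : ∀ p r u → r * u * p ≡ p * r * u
  shift = solve-∀

-- The coset relation on natural numbers.

-- x ~ y means y ∈ x G for G = { 1 + t q }, a group modulo N when N ∣ q².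
infix 4 _~_[_,_]
record _~_[_,_] (x y q N : ℕ) : Set where
  constructor via
  field
    multiplier : ℕ
    related    : y ≋ x * (1 + multiplier * q) [mod N ]

~-refl : x ~ x [ q , N ]
~-refl {x} = via 0 (≋-reflexive (sym (*-identityʳ x)))

~-resp-≋ : y ≋ z [mod N ] → x ~ z [ q , N ] → x ~ y [ q , N ]
~-resp-≋ y≋z (via t z≋) = via t (≋-trans y≋z z≋)

~⇒≋ : q ∣ N → x ~ y [ q , N ] → y ≋ x [mod q ]
~⇒≋ {q} {x = x} q∣N (via t y≋) = ≋-trans (≋-coarsen q∣N y≋)
  (balance {left = 0} {right = x * t} (expand x t q))
  where
  expand : ∀ x t q → x * (1 + t * q) + 0 ≡ x + x * t * q
  expand = solve-∀

-- With `~-unscale` this is the descent used for multiples of `p`: a common factor passes between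
-- the elements and the modulus, while `q` stays fixed.
~-scale : ∀ c → x ~ y [ q , N ] → c * x ~ c * y [ q , c * N ]
~-scale {x} c (via t y≋) =
  via t (≋-trans (≋-scale c y≋) (≋-reflexive (sym (*-assoc c x _))))

~-unscale : ∀ c .{{_ : NonZero c}} → c * x ~ c * y [ q , c * N ] → x ~ y [ q , N ]
~-unscale {x} c (via t cy≋) =
  via t (≋-unscale c (≋-trans cy≋ (≋-reflexive (*-assoc c x _))))

-- As `x * (1 + t * q) = x + (x * t) * q`, finding a multiplier modulo `q * P` reduces to a linear
-- congruence in `t` modulo `P`.
≋-solve⇒~ : ∀ t → x * t ≋ w [mod P ] → x ~ (x + w * q) [ q , q * P ]
≋-solve⇒~ {x} {w} {P} {q} t xt≋w = via t (≋-trans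
  (≋-+ˡ x (subst (λ α → α ≋ q * (x * t) [mod q * P ]) (*-comm q w) (≋-scale q (≋-sym xt≋w))))
  (≋-reflexive (factor x t q)))
  where
  factor : ∀ x t q → x + q * (x * t) ≡ x * (1 + t * q)
  factor = solve-∀

module _ {p : ℕ} (pr : Prime p) where

  private instance
    p≢0 : NonZero p
    p≢0 = prime⇒nonZero pr

  unit-solve : ∀ e w → ¬ p ∣ x → ∃[ t ] x * t ≋ w [mod p ^ e ]
  unit-solve {x} e w p∤x = proj₁ inverse * w ,
    subst₂ (_≋_[mod p ^ e ]) (*-assoc x (proj₁ inverse) w) (*-identityˡ w)
      (≋-* (proj₂ inverse) (≋-refl {x = w}))
    where
    inverse : ∃[ x⁻¹ ] x * x⁻¹ ≋ 1 [mod p ^ e ]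
    inverse = coprime⇒invertible x (p ^ e) {{m^n≢0 p e}} (∤⇒coprime-^ pr p∤x e)

  -- Refinement gives `y ≡ x + w * q`, and `x * t ≡ w` is solvable modulo `p ^ s` because `x` is
  -- invertible there. So the class of a unit is its full residue class modulo `q`.
  unit-~ : ∀ s → ¬ p ∣ x → y ≋ x [mod q ] → x ~ y [ q , q * p ^ s ]
  unit-~ {x} {y} {q} s p∤x y≋x = ~-resp-≋ (proj₂ refined)
    (≋-solve⇒~ (proj₁ solution) (proj₂ solution))
    where
    refined : ∃[ w ] y ≋ x + w * q [mod q * p ^ s ]
    refined = ≋-refine (p ^ s) {{m^n≢0 p s}} y≋x
    solution : ∃[ t ] x * t ≋ proj₁ refined [mod p ^ s ]
    solution = unit-solve s (proj₁ refined) p∤x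

  -- x + q b lies in x G exactly when the valuation of x is at most
  -- that of b.
  shift⇒∤ : ∀ s i c .{{_ : NonZero q}} → i < s → ¬ p ∣ c →
            x ~ (x + p ^ i * c * q) [ q , q * p ^ s ] → ¬ p ^ suc i ∣ x
  -- Cancelling `x` and then `q` leaves `x * t ≡ p ^ i * c` modulo `p ^ s`. As `i < s`, the power
  -- `p ^ suc i` divides the modulus, so if it divided `x` it would divide `p ^ i * c`.
  shift⇒∤ {q} {x} s i c i<s p∤c (via t x+a≋) p^1+i∣x = p∤c (*-cancelˡ-∣ (p ^ i) {{m^n≢0 p i}}
    (subst (_∣ p ^ i * c) (*-comm p (p ^ i))
      (≋-resp-∣ (^-monoʳ-∣ p i<s) xt≋b (∣m⇒∣m*n t p^1+i∣x))))
    where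
    factor : ∀ x t q → x * (1 + t * q) ≡ x + q * (x * t)
    factor = solve-∀
    xt≋b : x * t ≋ p ^ i * c [mod p ^ s ]
    xt≋b = ≋-unscale q (≋-sym (subst (_≋ q * (x * t) [mod q * p ^ s ]) (*-comm (p ^ i * c) q)
             (≋-cancel-+ˡ x (≋-trans x+a≋ (≋-reflexive (factor x t q))))))

  -- Write `x = p ^ j * u` with `j ≤ i` and `u` prime to `p`. The congruence `x * t ≡ p ^ i * c` is
  -- `p ^ j` times `u * t ≡ p ^ (i ∸ j) * c`, and the latter is solvable.
  ∤⇒shift : ∀ s i c → ¬ p ^ suc i ∣ x → x ~ (x + p ^ i * c * q) [ q , q * p ^ s ]
  ∤⇒shift {x} {q} s i c p^1+i∤x = decomposed (valuation p (suc i) p^1+i∤x)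
    where
    decomposed : (∃₂ λ j u → j < suc i × x ≡ p ^ j * u × ¬ p ∣ u) →
                 x ~ (x + p ^ i * c * q) [ q , q * p ^ s ]
    decomposed (j , u , s≤s j≤i , x≡ , p∤u) = ≋-solve⇒~ (proj₁ solution)
      (subst₂ (_≋_[mod p ^ s ]) p^jut≡xt p^jc′≡b (≋-*ˡ (p ^ j) (proj₂ solution)))
      where
      solution : ∃[ t ] u * t ≋ p ^ (i ∸ j) * c [mod p ^ s ]
      solution = unit-solve s (p ^ (i ∸ j) * c) p∤u
      p^jut≡xt : p ^ j * (u * proj₁ solution) ≡ x * proj₁ solution
      p^jut≡xt = trans (sym (*-assoc (p ^ j) u _)) (cong (_* proj₁ solution) (sym x≡))
      p^jc′≡b : p ^ j * (p ^ (i ∸ j) * c) ≡ p ^ i * c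
      p^jc′≡b = trans (sym (*-assoc (p ^ j) (p ^ (i ∸ j)) c))
        (cong (_* c) (trans (sym (^-distribˡ-+-* p j (i ∸ j))) (cong (p ^_) (m+[n∸m]≡n j≤i))))

  -- Related numbers agree modulo `q`, so a shift by `a` can succeed only if `a = b * q`. Then
  -- `0 < b < p ^ s`, which puts the valuation of `b` below `s`.
  shift-criterion : ∀ s a .{{_ : NonZero q}} → a ≢ 0 → a < q * p ^ s →
    (∀ x → ¬ x ~ (x + a) [ q , q * p ^ s ]) ⊎
    (∃[ i ] i < s × ∀ x → x ~ (x + a) [ q , q * p ^ s ] ⇔ (¬ p ^ suc i ∣ x))
  shift-criterion {q} s a a≢0 a<N with q ∣? a
  ... | no q∤a = inj₁ λ x x~x+a → q∤a (≋-resp-∣ ∣-refl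
    (≋-sym (≋-cancel-+ˡ {y = 0} x (≋-trans (~⇒≋ (m∣m*n (p ^ s)) x~x+a) (≋-reflexive (sym (+-identityʳ x))))))
    (q ∣0))
  ... | yes (divides b refl) = inj₂ (decomposed (valuation p s p^s∤b))
    where
    b<p^s : b < p ^ s
    b<p^s = *-cancelˡ-< q b (p ^ s) (subst (_< q * p ^ s) (*-comm b q) a<N)
    b≢0 : b ≢ 0
    b≢0 refl = a≢0 refl
    p^s∤b : ¬ p ^ s ∣ b
    p^s∤b p^s∣b = <⇒≱ b<p^s (∣⇒≤ {{≢-nonZero b≢0}} p^s∣b)
    decomposed : (∃₂ λ i c → i < s × b ≡ p ^ i * c × ¬ p ∣ c) →
      ∃[ i ] i < s × ∀ x → x ~ (x + b * q) [ q , q * p ^ s ] ⇔ (¬ p ^ suc i ∣ x)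
    decomposed (i , c , i<s , b≡ , p∤c) = i , i<s , λ x →
      subst (λ b → x ~ (x + b * q) [ q , q * p ^ s ] ⇔ (¬ p ^ suc i ∣ x)) (sym b≡)
        (mk⇔ (shift⇒∤ s i c i<s p∤c) (∤⇒shift s i c))

-- Cardinalities through duplicate-free lists.

unique⇒length≡ : {xs ys : List A} → Unique xs → Unique ys →
                 (∀ {z} → z ∈ xs → z ∈ ys) → (∀ {z} → z ∈ ys → z ∈ xs) → length xs ≡ length ys
unique⇒length≡ xs! ys! xs⊆ys ys⊆xs =
  ↭-length (∼bag⇒↭ (unique∧set⇒bag xs! ys! (mk⇔ xs⊆ys ys⊆xs)))

-- Injectivity is required on the members of the list only: sending a number to its coset is
-- injective on a transversal, not on all of `ℕ`.
unique-map⁺ : {f : A → B} {xs : List A} → (∀ {x y} → x ∈ xs → y ∈ xs → f x ≡ f y → x ≡ y) →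
              Unique xs → Unique (map f xs)
unique-map⁺ inj [] = []
unique-map⁺ inj (x∉xs ∷ xs!) =
  All.map⁺ (All.tabulate (λ y∈ fx≡fy → All.lookup x∉xs y∈ (inj (here refl) (there y∈) fx≡fy)))
  ∷ unique-map⁺ (λ x∈ y∈ → inj (there x∈) (there y∈)) xs!

length-cartesianProductWith : ∀ (f : A → B → C) xs ys →
  length (cartesianProductWith f xs ys) ≡ length xs * length ys
length-cartesianProductWith f [] ys = refl
length-cartesianProductWith f (x ∷ xs) ys = trans (List.length-++ (map (f x) ys))
  (cong₂ _+_ (List.length-map (f x) ys) (length-cartesianProductWith f xs ys))

∣⟦⟧∣≡length-filter : {P : Pred A ℓ} (P? : Decidable P) (f : Fin n → A) →
  ∣ ⟦ (λ i → P? (f i)) ⟧ ∣ ≡ length (filter P? (List.tabulate f))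
∣⟦⟧∣≡length-filter {n = zero} P? f = refl
∣⟦⟧∣≡length-filter {n = suc n} P? f with P? (f Fin.zero)
... | yes _ = cong suc (∣⟦⟧∣≡length-filter P? (f ∘ Fin.suc))
... | no _  = ∣⟦⟧∣≡length-filter P? (f ∘ Fin.suc)

∣⟦⟧∣-enumerated : {P : Pred (Fin n) ℓ} (P? : Decidable P) (g : Fin m → Fin n) →
  (∀ {i j} → g i ≡ g j → i ≡ j) → (∀ j → P (g j)) → (∀ x → P x → ∃[ j ] x ≡ g j) →
  ∣ ⟦ P? ⟧ ∣ ≡ m
∣⟦⟧∣-enumerated {n = n} {m = m} P? g g-inj sound complete = begin
  ∣ ⟦ P? ⟧ ∣                       ≡⟨ ∣⟦⟧∣≡length-filter P? id ⟩
  length (filter P? (allFin n))    ≡⟨ unique⇒length≡ (Unique.filter⁺ P? (Unique.allFin⁺ n))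
                                        (Unique.tabulate⁺ g-inj) to from ⟩
  length (List.tabulate g)         ≡⟨ List.length-tabulate g ⟩
  m                                ∎
  where
  open ≡-Reasoning
  to : ∀ {z} → z ∈ filter P? (allFin n) → z ∈ List.tabulate g
  to {z} z∈ with complete z (proj₂ (∈-filter⁻ P? {xs = allFin n} z∈))
  ... | j , refl = ∈-tabulate⁺ j
  from : ∀ {z} → z ∈ List.tabulate g → z ∈ filter P? (allFin n)
  from z∈ with ∈-tabulate⁻ z∈
  ... | j , refl = ∈-filter⁺ P? (∈-allFin (g j)) (sound j)

∣⟦⟧∣-complement : {P Q : Pred (Fin n) ℓ} (P? : Decidable P) (Q? : Decidable Q) →
  (∀ x → P x ⇔ (¬ Q x)) → ∣ ⟦ P? ⟧ ∣ ≡ n ∸ ∣ ⟦ Q? ⟧ ∣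
∣⟦⟧∣-complement P? Q? P⇔¬Q = trans (cong ∣_∣ (⊆-antisym
    (λ {x} x∈P → x∉p⇒x∈∁p (λ x∈Q → Equivalence.to (P⇔¬Q x) (∈⟦⟧⁻ P? x∈P) (∈⟦⟧⁻ Q? x∈Q)))
    (λ {x} x∈∁Q → ∈⟦⟧⁺ P? (Equivalence.from (P⇔¬Q x) (λ Qx → x∈∁p⇒x∉p x∈∁Q (∈⟦⟧⁺ Q? Qx))))))
  (∣∁p∣≡n∸∣p∣ ⟦ Q? ⟧)

-- Counting multiples, and totients of prime powers.

-- The shift c covers both the residues 0 … N - 1 and the numbers 1 … N.
∣multiples∣ : ∀ d M c → c ≤ 1 → N ≡ M * suc d →
              ∣ ⟦ (λ (x : Fin N) → suc d ∣? c + toℕ x) ⟧ ∣ ≡ M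
∣multiples∣ d M c c≤1 refl = ∣⟦⟧∣-enumerated (λ x → suc d ∣? c + toℕ x) (λ i → Fin.combine i (last c))
    (λ {i} {j} → Fin.combine-injectiveˡ i (last c) j (last c)) sound complete
  where
  -- In each block of `suc d` consecutive numbers exactly one offset `r` makes `c + r` divisible by
  -- `suc d`: `0` if `c = 0`, and `d` if `c = 1`.
  last : ℕ → Fin (suc d)
  last zero    = Fin.zero
  last (suc _) = Fin.fromℕ d
  split : ∀ c e i r → c + (e * i + r) ≡ e * i + (c + r)
  split = solve-∀
  combined : ∀ i r → c + toℕ (Fin.combine {M} {suc d} i r) ≡ suc d * toℕ i + (c + toℕ r)
  combined i r = trans (cong (c +_) (Fin.toℕ-combine i r)) (split c (suc d) (toℕ i) (toℕ r))
  last-∣ : ∀ {c} → c ≤ 1 → suc d ∣ c + toℕ (last c)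
  last-∣ z≤n = suc d ∣0
  last-∣ (s≤s z≤n) = ∣-reflexive (cong suc (sym (Fin.toℕ-fromℕ d)))
  last-unique : ∀ {c} → c ≤ 1 → ∀ r → suc d ∣ c + toℕ r → r ≡ last c
  last-unique z≤n Fin.zero _ = refl
  last-unique z≤n r@(Fin.suc _) d∣r = contradiction (∣⇒≤ d∣r) (<⇒≱ (Fin.toℕ<n r))
  last-unique (s≤s z≤n) r d∣1+r = Fin.toℕ-injective
    (trans (≤-antisym (≤-pred (Fin.toℕ<n r)) (≤-pred (∣⇒≤ d∣1+r))) (sym (Fin.toℕ-fromℕ d)))
  sound : ∀ i → suc d ∣ c + toℕ (Fin.combine {M} i (last c))
  sound i = subst (suc d ∣_) (sym (combined i (last c)))
    (∣m∣n⇒∣m+n (m∣m*n (toℕ i)) (last-∣ c≤1))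
  complete : ∀ x → suc d ∣ c + toℕ x → ∃[ i ] x ≡ Fin.combine i (last c)
  complete x d∣c+x with Fin.combine-surjective {M} {suc d} x
  ... | i , r , refl = i , cong (Fin.combine i) (last-unique c≤1 r
    (∣m+n∣m⇒∣n (subst (suc d ∣_) (combined i r) d∣c+x) (m∣m*n (toℕ i))))

∣multiples-^∣ : .{{NonZero p}} → ∀ c m n → c ≤ 1 → m ≤ n →
                ∣ ⟦ (λ (x : Fin (p ^ n)) → p ^ m ∣? c + toℕ x) ⟧ ∣ ≡ p ^ (n ∸ m)
∣multiples-^∣ {p} c m n c≤1 m≤n with p ^ m in p^m≡ | m^n>0 p m
... | suc d | _ = ∣multiples∣ d (p ^ (n ∸ m)) c c≤1 (begin
    p ^ n                ≡⟨ cong (p ^_) (m∸n+n≡m m≤n) ⟨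
    p ^ (n ∸ m + m)      ≡⟨ ^-distribˡ-+-* p (n ∸ m) m ⟩
    p ^ (n ∸ m) * p ^ m  ≡⟨ cong (p ^ (n ∸ m) *_) p^m≡ ⟩
    p ^ (n ∸ m) * suc d  ∎)
  where open ≡-Reasoning

-- Coprimality to `p ^ suc e` means not being a multiple of `p`. The totient runs over `1` to
-- `p ^ suc e`, hence the shift `1`; `p` is written `p ^ 1` to fit the count of multiples of a
-- power.
φ-prime-^ : Prime p → ∀ e → φ (p ^ suc e) ≡ p ^ suc e ∸ p ^ e
φ-prime-^ {p} pr e = trans
  (∣⟦⟧∣-complement {n = p ^ suc e} (λ i → coprime? (suc (toℕ i)) (p ^ suc e)) (λ i → p ^ 1 ∣? 1 + toℕ i)
    (λ i → mk⇔ (coprime⇒∤ (suc (toℕ i))) (∤⇒coprime (suc (toℕ i)))))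
  (cong (p ^ suc e ∸_) (∣multiples-^∣ {{prime⇒nonZero pr}} 1 1 (suc e) (s≤s z≤n) (s≤s z≤n)))
  where
  coprime⇒∤ : ∀ x → Coprime x (p ^ suc e) → ¬ p ^ 1 ∣ x
  coprime⇒∤ x c p^1∣x with c {p} (subst (_∣ x) (*-identityʳ p) p^1∣x , m∣m*n (p ^ e))
  ... | refl = ¬prime[1] pr
  ∤⇒coprime : ∀ x → ¬ p ^ 1 ∣ x → Coprime x (p ^ suc e)
  ∤⇒coprime x p^1∤x = ∤⇒coprime-^ pr (p^1∤x ∘ subst (_∣ x) (sym (*-identityʳ p))) (suc e)

-- Each totient is the drop from one power of `p` to the next, so the sum telescopes. Keeping the
-- last power on the left avoids truncated subtraction; removing the first term lowers `i` and `k`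
-- together.
∑φ-prime-^ : Prime p → ∀ i k → i ≤ k →
             sum (applyUpTo (λ j → φ (p ^ (k ∸ j))) i) + p ^ (k ∸ i) ≡ p ^ k
∑φ-prime-^ pr zero k i≤k = refl
∑φ-prime-^ {p} pr (suc i) (suc k) (s≤s i≤k) = begin
  φ (p ^ suc k) + Σφ + p ^ (k ∸ i)    ≡⟨ +-assoc (φ (p ^ suc k)) Σφ (p ^ (k ∸ i)) ⟩
  φ (p ^ suc k) + (Σφ + p ^ (k ∸ i))  ≡⟨ cong₂ _+_ (φ-prime-^ pr k) (∑φ-prime-^ pr i k i≤k) ⟩
  p ^ suc k ∸ p ^ k + p ^ k           ≡⟨ m∸n+n≡m (^-monoʳ-≤ p {{prime⇒nonZero pr}} (n≤1+n k)) ⟩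
  p ^ suc k                           ∎
  where
  open ≡-Reasoning
  Σφ = sum (applyUpTo (λ j → φ (p ^ (k ∸ j))) i)

-- A transversal of the coset relation.

-- Representatives of the classes of x ~ y [ q , q * p ^ s ] with p = π and
-- q = Q: those prime to p are the residues modulo q prime to p, and dividing the
-- others by p lowers s by one.
module _ (p′ M : ℕ) (pr : Prime (suc p′)) .{{_ : NonZero (M * suc p′)}} where

  private
    π Q : ℕ
    π = suc p′
    Q = M * π

    π∣Q : π ∣ Q
    π∣Q = n∣m*n M

  -- A residue below `M * π` is `π * i + r` with `r < π`; taking `r = suc j` omits exactly the
  -- multiples of `π`.
  coprimeResidues : List ℕ
  coprimeResidues = cartesianProductWith (λ (i : Fin M) (j : Fin p′) → toℕ (Fin.combine i (Fin.suc j)))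
    (allFin M) (allFin p′)

  representatives : ℕ → List ℕ
  representatives zero    = upTo Q
  representatives (suc s) = coprimeResidues ++ map (π *_) (representatives s)

  length-representatives : ∀ s → length (representatives s) ≡ Q + s * (M * p′)
  length-representatives zero = trans (List.length-upTo Q) (sym (+-identityʳ Q))
  length-representatives (suc s) = begin
    length (coprimeResidues ++ map (π *_) (representatives s))
      ≡⟨ List.length-++ coprimeResidues ⟩
    length coprimeResidues + length (map (π *_) (representatives s))
      ≡⟨ cong₂ _+_ (trans (length-cartesianProductWith _ (allFin M) (allFin p′))
                     (cong₂ _*_ (List.length-tabulate {n = M} id) (List.length-tabulate {n = p′} id)))
           (trans (List.length-map (π *_) (representatives s)) (length-representatives s)) ⟩
    M * p′ + (Q + s * (M * p′))
      ≡⟨ exchange (M * p′) Q (s * (M * p′)) ⟩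
    Q + (M * p′ + s * (M * p′)) ∎
    where
    open ≡-Reasoning
    exchange : ∀ a b c → a + (b + c) ≡ b + (a + c)
    exchange = solve-∀

  ∈-coprimeResidues⁻ : x ∈ coprimeResidues → x < Q × ¬ π ∣ x
  ∈-coprimeResidues⁻ x∈ with ∈-cartesianProductWith⁻ _ (allFin M) (allFin p′) x∈
  ... | i , j , _ , _ , refl = Fin.toℕ<n (Fin.combine i (Fin.suc j)) , λ p∣x →
    contradiction
      (∣⇒≤ (∣m+n∣m⇒∣n (subst (π ∣_) (Fin.toℕ-combine i (Fin.suc j)) p∣x) (m∣m*n (toℕ i))))
      (<⇒≱ (Fin.toℕ<n (Fin.suc j)))

  ∈-coprimeResidues⁺ : x < Q → ¬ π ∣ x → x ∈ coprimeResidues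
  ∈-coprimeResidues⁺ {x} x<Q π∤x with Fin.combine-surjective {M} {π} (fromℕ< x<Q)
  ... | i , Fin.zero , eq = contradiction
    (subst (π ∣_) (trans (sym (Fin.toℕ-combine i Fin.zero)) (trans (cong toℕ eq) (Fin.toℕ-fromℕ< x<Q)))
      (∣m∣n⇒∣m+n (m∣m*n (toℕ i)) (π ∣0)))
    π∤x
  ... | i , Fin.suc j , eq = subst (_∈ coprimeResidues) (trans (cong toℕ eq) (Fin.toℕ-fromℕ< x<Q))
    (∈-cartesianProductWith⁺ (λ (i : Fin M) (j : Fin p′) → toℕ (Fin.combine i (Fin.suc j)))
      (∈-allFin i) (∈-allFin j))

  coprimeResidues-unique : Unique coprimeResidues
  coprimeResidues-unique = Unique.cartesianProductWith⁺ _ injective (Unique.allFin⁺ M) (Unique.allFin⁺ p′)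
    where
    injective : ∀ {w x : Fin M} {y z : Fin p′} →
      toℕ (Fin.combine w (Fin.suc y)) ≡ toℕ (Fin.combine x (Fin.suc z)) → w ≡ x × y ≡ z
    injective {w} {x} {y} {z} eq
      with refl , refl ← Fin.combine-injective w (Fin.suc y) x (Fin.suc z) (Fin.toℕ-injective eq)
      = refl , refl

  representatives-unique : ∀ s → Unique (representatives s)
  representatives-unique zero = Unique.upTo⁺ Q
  representatives-unique (suc s) = Unique.++⁺ coprimeResidues-unique
    (Unique.map⁺ (*-cancelˡ-≡ _ _ π) (representatives-unique s)) disjoint
    where
    disjoint : ∀ {x} → ¬ (x ∈ coprimeResidues × x ∈ map (π *_) (representatives s))
    disjoint (x∈ , x∈′) with ∈-map⁻ (π *_) x∈′
    ... | y , _ , refl = proj₂ (∈-coprimeResidues⁻ x∈) (m∣m*n y)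

  modulus : ∀ s → Q * π ^ suc s ≡ π * (Q * π ^ s)
  modulus s = rearrange Q π (π ^ s)
    where
    rearrange : ∀ Q π r → Q * (π * r) ≡ π * (Q * r)
    rearrange = solve-∀

  -- Related numbers agree modulo `Q`, hence modulo `π`, so a unit is never related to a multiple of
  -- `π`. Two units below `Q` then coincide, and two multiples of `π` are divided by `π` for the
  -- induction.
  representatives-separate : ∀ s → x ∈ representatives s → y ∈ representatives s →
                             x ~ y [ Q , Q * π ^ s ] → x ≡ y
  representatives-separate zero x∈ y∈ x~y =
    sym (≋⇒≡ (∈-upTo⁻ y∈) (∈-upTo⁻ x∈) (~⇒≋ (m∣m*n 1) x~y))
  representatives-separate {x} {y} (suc s) x∈ y∈ x~y =
    compare (∈-++⁻ coprimeResidues x∈) (∈-++⁻ coprimeResidues y∈)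
    where
    y≋x : y ≋ x [mod Q ]
    y≋x = ~⇒≋ (m∣m*n (π ^ suc s)) x~y
    compare : x ∈ coprimeResidues ⊎ x ∈ map (π *_) (representatives s) →
              y ∈ coprimeResidues ⊎ y ∈ map (π *_) (representatives s) → x ≡ y
    compare (inj₁ x∈) (inj₁ y∈) = sym (≋⇒≡ (proj₁ (∈-coprimeResidues⁻ y∈)) (proj₁ (∈-coprimeResidues⁻ x∈)) y≋x)
    compare (inj₁ x∈) (inj₂ y∈) with ∈-map⁻ (π *_) y∈
    ... | y′ , _ , refl = contradiction (≋-resp-∣ π∣Q y≋x (m∣m*n y′)) (proj₂ (∈-coprimeResidues⁻ x∈))
    compare (inj₂ x∈) (inj₁ y∈) with ∈-map⁻ (π *_) x∈
    ... | x′ , _ , refl = contradiction (≋-resp-∣ π∣Q (≋-sym y≋x) (m∣m*n x′)) (proj₂ (∈-coprimeResidues⁻ y∈))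
    compare (inj₂ x∈) (inj₂ y∈) with ∈-map⁻ (π *_) x∈ | ∈-map⁻ (π *_) y∈
    ... | x′ , x′∈ , x≡ | y′ , y′∈ , y≡ = trans x≡ (trans (cong (π *_)
      (representatives-separate s x′∈ y′∈ (~-unscale π x~y′))) (sym y≡))
      where
      x~y′ : π * x′ ~ π * y′ [ Q , π * (Q * π ^ s) ]
      x~y′ = subst (π * x′ ~ π * y′ [ Q ,_]) (modulus s)
        (subst₂ (λ x y → x ~ y [ Q , Q * π ^ suc s ]) x≡ y≡ x~y)

  -- At level `0` the modulus is `Q` itself and reduction modulo `Q` suffices. Above it, a unit is
  -- related to its residue by `unit-~`, and a multiple of `π` is handled one level down.
  representatives-cover : ∀ s x → ∃[ y ] y ∈ representatives s × y ~ x [ Q , Q * π ^ s ]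
  representatives-cover zero x = x % Q , ∈-upTo⁺ (m%n<n x Q) ,
    via 0 (subst (λ N → x ≋ x % Q * 1 [mod N ]) (sym (*-identityʳ Q))
      (≋-trans (≋-sym (%≋ x)) (≋-reflexive (sym (*-identityʳ (x % Q))))))
  representatives-cover (suc s) x with π ∣? x
  ... | no π∤x = x % Q , ∈-++⁺ˡ (∈-coprimeResidues⁺ (m%n<n x Q) π∤x%Q) , unit-~ pr (suc s) π∤x%Q (≋-sym (%≋ x))
    where
    π∤x%Q : ¬ π ∣ x % Q
    π∤x%Q p∣x%Q = π∤x (≋-resp-∣ π∣Q (%≋ x) p∣x%Q)
  ... | yes (divides x′ refl) with representatives-cover s x′
  ... | y , y∈ , y~x′ = π * y , ∈-++⁺ʳ coprimeResidues (∈-map⁺ (π *_) y∈) ,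
    subst₂ (π * y ~_[ Q ,_]) (*-comm π x′) (sym (modulus s)) (~-scale π y~x′)

record Transversal (q N : ℕ) (xs : List ℕ) : Set where
  field
    unique   : Unique xs
    separate : ∀ {x y} → x ∈ xs → y ∈ xs → x ~ y [ q , N ] → x ≡ y
    cover    : ∀ x → ∃[ y ] y ∈ xs × y ~ x [ q , N ]

transversal : Prime p → ∀ m s → ∃[ xs ]
  Transversal (p ^ suc m) (p ^ suc m * p ^ s) xs × length xs ≡ (s * p + p ∸ s) * p ^ m
transversal {zero} pr = contradiction pr ¬prime[0]
transversal {suc p′} pr m s =
  representatives p′ M pr s ,
  subst (λ q → Transversal q (q * suc p′ ^ s) (representatives p′ M pr s)) (*-comm M (suc p′)) (record
    { unique   = representatives-unique p′ M pr s
    ; separate = representatives-separate p′ M pr s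
    ; cover    = representatives-cover p′ M pr s
    }) ,
  (begin
    length (representatives p′ M pr s)    ≡⟨ length-representatives p′ M pr s ⟩
    M * suc p′ + s * (M * p′)             ≡⟨ collect M p′ s ⟩
    -- The truncated `∸ s` is exact: with `p = suc p′`, the number `s * p + p` is
    -- `s + (s * p′ + p)`.
    (s * p′ + suc p′) * M                 ≡⟨ cong (_* M) (m+n∸m≡n s (s * p′ + suc p′)) ⟨
    (s + (s * p′ + suc p′) ∸ s) * M       ≡⟨ cong (λ α → (α ∸ s) * M) (expand s p′) ⟩
    (s * suc p′ + suc p′ ∸ s) * M         ∎)
  where
  open ≡-Reasoning
  M = suc p′ ^ m
  instance
    M*p≢0 : NonZero (M * suc p′)
    M*p≢0 = m*n≢0 M (suc p′) {{m^n≢0 (suc p′) m}}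
  collect : ∀ M p′ s → M * suc p′ + s * (M * p′) ≡ (s * p′ + suc p′) * M
  collect = solve-∀
  expand : ∀ s p′ → s + (s * p′ + suc p′) ≡ s * suc p′ + suc p′
  expand = solve-∀

-- The generated subgroup and its cosets.

module Cosets (n q e P : ℕ) .{{_ : NonZero n}} .{{_ : NonZero q}} .{{_ : NonZero P}}
              (q² : q * q ≡ e * n) (n≡qP : n ≡ q * P) where

  open ℤMod n

  q∣n : q ∣ n
  q∣n = divides P (trans n≡qP (*-comm q P))

  -- The cross term `t * u * q * q` is a multiple of `n`, so `t ↦ 1 + t * q` turns addition into
  -- multiplication.
  1+tq-* : ∀ t u → (1 + t * q) * (1 + u * q) ≋ 1 + (t + u) * q [mod n ]
  1+tq-* t u = balance {left = 0} {right = t * u * e} (begin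
    (1 + t * q) * (1 + u * q) + 0         ≡⟨ expand t u q ⟩
    1 + (t + u) * q + t * u * (q * q)     ≡⟨ cong (λ α → 1 + (t + u) * q + t * u * α) q² ⟩
    1 + (t + u) * q + t * u * (e * n)     ≡⟨ cong (1 + (t + u) * q +_) (*-assoc (t * u) e n) ⟨
    1 + (t + u) * q + t * u * e * n       ∎)
    where
    open ≡-Reasoning
    expand : ∀ t u q → (1 + t * q) * (1 + u * q) + 0 ≡ 1 + (t + u) * q + t * u * (q * q)
    expand = solve-∀

  ~-trans : x ~ y [ q , n ] → y ~ z [ q , n ] → x ~ z [ q , n ]
  ~-trans {x} {y} (via t y≋) (via u z≋) = via (t + u) (≋-trans z≋
    (≋-trans (≋-* y≋ (≋-refl {x = 1 + u * q}))
    (≋-trans (≋-reflexive (*-assoc x (1 + t * q) (1 + u * q))) (≋-*ˡ x (1+tq-* t u)))))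

  ~-sym : x ~ y [ q , n ] → y ~ x [ q , n ]
  -- The multiplier `t * pred n` stands for `- t`: added to `t` it gives `t * n`.
  ~-sym {x} {y} (via t y≋) = via (t * pred n) (≋-sym
    (≋-trans (≋-* y≋ (≋-refl {x = 1 + t * pred n * q}))
    (≋-trans (≋-reflexive (*-assoc x (1 + t * q) (1 + t * pred n * q)))
    (≋-trans (≋-*ˡ x (1+tq-* t (t * pred n)))
    (≋-trans (≋-*ˡ x (balance {left = 0} {right = t * q} vanish)) (≋-reflexive (*-identityʳ x)))))))
    where
    open ≡-Reasoning
    collect : ∀ t q m → 1 + (t + t * m) * q + 0 ≡ 1 + t * q * suc m
    collect = solve-∀
    vanish : 1 + (t + t * pred n) * q + 0 * n ≡ 1 + t * q * n
    vanish = trans (collect t q (pred n)) (cong (λ α → 1 + t * q * α) (suc-pred n))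

  toℕ-[] : ∀ a → toℕ [ a ] ≋ a [mod n ]
  toℕ-[] a = subst (_≋ a [mod n ]) (sym (Fin.toℕ-fromℕ< (m%n<n a n))) (%≋ a)

  toℕ-≋-injective : {x y : ℤₙ} → toℕ x ≋ toℕ y [mod n ] → x ≡ y
  toℕ-≋-injective {x} {y} = Fin.toℕ-injective ∘ ≋⇒≡ (Fin.toℕ<n x) (Fin.toℕ<n y)

  module _ (unit : IsUnit [ q + 1 ]) where

    G : UnitSubgroup
    G = ⟨ [ q + 1 ] , unit ⟩

    open UnitSubgroup G
    open IsUnitSubgroup isUnitSubgroup

    generator : [ q + 1 ] ∈ₛ elements
    generator = ∈⟦⟧⁺ (inGenerated? ([ q + 1 ] , unit)) (λ _ _ u∈ → u∈)

    -- By additivity of multipliers, `1 + t * q` is the `t`-th power of the generator.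
    1+tq∈G : ∀ t → [ 1 + t * q ] ∈ₛ elements
    1+tq∈G zero = 1-closed
    1+tq∈G (suc t) = subst (_∈ₛ elements) (toℕ-≋-injective
      (≋-trans (toℕ-[] _) (≋-trans (≋-* (toℕ-[] (1 + t * q)) (toℕ-[] (q + 1)))
      (≋-trans (≋-reflexive (cong ((1 + t * q) *_) (q+1≡ q)))
      (≋-trans (1+tq-* t 1)
      (≋-trans (≋-reflexive (cong (λ α → 1 + α * q) (+-comm t 1))) (≋-sym (toℕ-[] _))))))))
      (*-closed [ 1 + t * q ] (1+tq∈G t) [ q + 1 ] generator)
      where
      q+1≡ : ∀ q → q + 1 ≡ 1 + 1 * q
      q+1≡ = solve-∀

    ≋1⇒1+tq : ∀ x → x ≋ 1 [mod q ] → ∃[ t ] x ≋ 1 + t * q [mod n ]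
    ≋1⇒1+tq x x≋1 = subst (λ N → ∃[ t ] x ≋ 1 + t * q [mod N ]) (sym n≡qP) (≋-refine P x≋1)

    ≋1? : Decidable (λ (x : ℤₙ) → toℕ x ≋ 1 [mod q ])
    ≋1? x = ≋? (toℕ x) 1

    -- This bounds `G` from above: membership in `G` means membership in every subgroup containing
    -- the generator, and it gets tested on this one. Its elements are units because each is some
    -- `1 + t * q`, already known to lie in `G`.
    1+qℤ-isUnitSubgroup : IsUnitSubgroup ⟦ ≋1? ⟧
    1+qℤ-isUnitSubgroup = record
      { units     = λ x x∈ → let (t , x≋) = ≋1⇒1+tq (toℕ x) (∈⟦⟧⁻ ≋1? x∈) in
                    subst IsUnit (toℕ-≋-injective (≋-trans (toℕ-[] _) (≋-sym x≋)))
                      (units [ 1 + t * q ] (1+tq∈G t))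
      ; 1-closed  = ∈⟦⟧⁺ ≋1? (≋-coarsen q∣n (toℕ-[] 1))
      ; *-closed  = λ x x∈ y y∈ → ∈⟦⟧⁺ ≋1? (≋-trans (≋-coarsen q∣n (toℕ-[] _))
                    (≋-* (∈⟦⟧⁻ ≋1? x∈) (∈⟦⟧⁻ ≋1? y∈)))
      ; ⁻¹-closed = λ x x∈ y xy≡1 → ∈⟦⟧⁺ ≋1?
          (≋-trans (≋-reflexive (sym (*-identityˡ (toℕ y))))
          (≋-trans (≋-* (≋-sym (∈⟦⟧⁻ ≋1? x∈)) ≋-refl)
          (≋-coarsen q∣n (≋-trans (≋-sym (toℕ-[] _)) (≋-trans (≋-reflexive (cong toℕ xy≡1)) (toℕ-[] 1))))))
      }

    ∈G⇒1+tq : ∀ {x} → x ∈ₛ elements → ∃[ t ] toℕ x ≋ 1 + t * q [mod n ]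
    ∈G⇒1+tq {x} x∈ = ≋1⇒1+tq (toℕ x) (∈⟦⟧⁻ ≋1?
      (∈⟦⟧⁻ (inGenerated? ([ q + 1 ] , unit)) x∈ ⟦ ≋1? ⟧ 1+qℤ-isUnitSubgroup
        (∈⟦⟧⁺ ≋1? (≋-trans (≋-coarsen q∣n (toℕ-[] (q + 1))) (balance {left = 0} {right = 1} (q+1≡ q))))))
      where
      q+1≡ : ∀ q → q + 1 + 0 ≡ 1 + 1 * q
      q+1≡ = solve-∀

    inCoset? : ∀ r → Decidable (λ x → ∃[ g ] g ∈ₛ elements × x ≡ r *ₙ g)
    inCoset? r x = any? (λ g → (g ∈? elements) ×-dec (x Fin.≟ r *ₙ g))

    ∈coset⇔~ : ∀ x y → y ∈ₛ coset G x ⇔ toℕ x ~ toℕ y [ q , n ]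
    ∈coset⇔~ x y = mk⇔ to from
      where
      to : y ∈ₛ coset G x → toℕ x ~ toℕ y [ q , n ]
      to y∈ =
        let (g , g∈ , y≡xg) = ∈⟦⟧⁻ (inCoset? x) y∈
            (t , g≋)        = ∈G⇒1+tq g∈
        in via t (≋-trans (≋-reflexive (cong toℕ y≡xg)) (≋-trans (toℕ-[] _) (≋-*ˡ (toℕ x) g≋)))
      from : toℕ x ~ toℕ y [ q , n ] → y ∈ₛ coset G x
      from (via t y≋) = ∈⟦⟧⁺ (inCoset? x) ([ 1 + t * q ] , 1+tq∈G t , toℕ-≋-injective
        (≋-trans y≋ (≋-trans (≋-*ˡ (toℕ x) (≋-sym (toℕ-[] _))) (≋-sym (toℕ-[] _)))))

    coset≡⇔~ : ∀ x y → coset G x ≡ coset G y ⇔ toℕ x ~ toℕ y [ q , n ]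
    coset≡⇔~ x y = mk⇔ to from
      where
      to : coset G x ≡ coset G y → toℕ x ~ toℕ y [ q , n ]
      to eq = Equivalence.to (∈coset⇔~ x y)
        (subst (y ∈ₛ_) (sym eq) (Equivalence.from (∈coset⇔~ y y) ~-refl))
      ⊆ : ∀ {x y} → toℕ x ~ toℕ y [ q , n ] → ∀ {z} → z ∈ₛ coset G y → z ∈ₛ coset G x
      ⊆ x~y z∈ = Equivalence.from (∈coset⇔~ _ _) (~-trans x~y (Equivalence.to (∈coset⇔~ _ _) z∈))
      from : toℕ x ~ toℕ y [ q , n ] → coset G x ≡ coset G y
      from x~y = ⊆-antisym (⊆ (~-sym x~y)) (⊆ x~y)

    coset[]≡⇔~ : ∀ x y → coset G [ x ] ≡ coset G [ y ] ⇔ x ~ y [ q , n ]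
    coset[]≡⇔~ x y = mk⇔
      (λ eq → ~-trans (~[] x) (~-trans (Equivalence.to (coset≡⇔~ [ x ] [ y ]) eq) ([]~ y)))
      (λ x~y → Equivalence.from (coset≡⇔~ [ x ] [ y ])
        (~-trans ([]~ x) (~-trans x~y (~[] y))))
      where
      ~[] : ∀ a → a ~ toℕ [ a ] [ q , n ]
      ~[] a = ~-resp-≋ (toℕ-[] a) ~-refl
      []~ : ∀ a → toℕ [ a ] ~ a [ q , n ]
      []~ a = ~-resp-≋ (≋-sym (toℕ-[] a)) ~-refl

    -- Listing the cosets of a transversal gives a duplicate-free list with the same members as the
    -- deduplicated list of all cosets.
    ∣D∣≡length : ∀ {xs} → Transversal q n xs → ∣D∣ G ≡ length xs
    ∣D∣≡length {xs} T = trans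
      (unique⇒length≡ (deduplicate-! _≟ₛ_ (map (coset G) (allFin n)))
        (unique-map⁺ {f = λ x → coset G [ x ]}
          (λ x∈ y∈ eq → separate x∈ y∈ (Equivalence.to (coset[]≡⇔~ _ _) eq)) unique)
        to from)
      (List.length-map (λ x → coset G [ x ]) xs)
      where
      open Transversal T
      _≟ₛ_ = Vec.≡-dec Bool._≟_
      to : ∀ {C} → C ∈ deduplicate _≟ₛ_ (map (coset G) (allFin n)) → C ∈ map (λ x → coset G [ x ]) xs
      to C∈ =
        let (r , _ , C≡rG)  = ∈-map⁻ (coset G) (∈-deduplicate⁻ _≟ₛ_ (map (coset G) (allFin n)) C∈)
            (y , y∈ , y~r)  = cover (toℕ r)
            [y]~r           = ~-trans (~-resp-≋ (≋-sym (toℕ-[] y)) ~-refl) y~r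
        in subst (_∈ map (λ x → coset G [ x ]) xs)
             (trans (Equivalence.from (coset≡⇔~ [ y ] r) [y]~r) (sym C≡rG))
             (∈-map⁺ (λ x → coset G [ x ]) y∈)
      from : ∀ {C} → C ∈ map (λ x → coset G [ x ]) xs → C ∈ deduplicate _≟ₛ_ (map (coset G) (allFin n))
      from C∈ =
        let (y , _ , C≡[y]G) = ∈-map⁻ (λ x → coset G [ x ]) C∈
        in ∈-deduplicate⁺ _≟ₛ_
             (subst (_∈ map (coset G) (allFin n)) (sym C≡[y]G) (∈-map⁺ (coset G) (∈-allFin [ y ])))

    indexGroup : FiniteAbelianGroup 0ℓ 0ℓ
    indexGroup = ℤ/ (∣D∣ G) (∣D∣-nonZero n G)

    module _ (h : Bijection (D G) (setoid (Fin (∣D∣ G)))) where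

      cosetIndex-surjective : ∀ j → ∃[ x ] Bijection.to h (cosetOf G x) ≡ j
      cosetIndex-surjective j =
        let ((C , r , C≡rG) , h≡j) = Bijection.surjective h j
        -- The preimage carries its own subset and representative; `D` compares subsets only, so
        -- `cosetOf G r` is equal to it there.
        in r , h≡j {cosetOf G r} (sym C≡rG)

      -- Injectivity of `h` reduces equal indices to equal cosets, so the choice of `h` is
      -- immaterial. The sum on the right is left unreduced, ready for the arithmetic criterion.
      cosetIndex-shift : ∀ x a →
        Bijection.to h (cosetOf G (x +ₙ a)) ≡ Bijection.to h (cosetOf G x) ⇔
        toℕ x ~ (toℕ x + toℕ a) [ q , n ]
      cosetIndex-shift x a = mk⇔
        (λ eq → ~-resp-≋ (≋-sym (toℕ-[] _))
          (Equivalence.to (coset≡⇔~ x (x +ₙ a)) (sym (Bijection.injective h eq))))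
        (λ x~x+a → Bijection.cong h {cosetOf G (x +ₙ a)} {cosetOf G x} (sym
          (Equivalence.from (coset≡⇔~ x (x +ₙ a)) (~-resp-≋ (toℕ-[] _) x~x+a))))

      private
        inImage? : Decidable (λ j → ∃[ x ] Bijection.to h (cosetOf G x) ≡ j)
        inImage? j = any? (λ x → FiniteAbelianGroup._≈?_ indexGroup (Bijection.to h (cosetOf G x)) j)

        unmoved? : ∀ a → Decidable (λ x →
          Bijection.to h (cosetOf G (x +ₙ a)) ≡ Bijection.to h (cosetOf G x))
        unmoved? a x = FiniteAbelianGroup._≈?_ indexGroup
          (Bijection.to h (cosetOf G (x +ₙ a))) (Bijection.to h (cosetOf G x))

      ∣image∣≡∣D∣ : ∣ image additiveGroup indexGroup (cosetIndex G h) ∣ ≡ ∣D∣ G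
      ∣image∣≡∣D∣ = ∣⟦⟧∣-enumerated inImage? id id cosetIndex-surjective (λ j _ → j , refl)

      zeroDifferences-empty : ∀ a → (∀ x → ¬ x ~ (x + toℕ a) [ q , n ]) →
        ∣ zeroDifferences additiveGroup indexGroup (cosetIndex G h) a ∣ ≡ 0
      zeroDifferences-empty a never = ∣⟦⟧∣-enumerated (unmoved? a) (λ ()) (λ { {()} }) (λ ())
        (λ x eq → contradiction (Equivalence.to (cosetIndex-shift x a) eq) (never (toℕ x)))

      ∣zeroDifferences∣ : ∀ a d → (∀ x → x ~ (x + toℕ a) [ q , n ] ⇔ (¬ d ∣ x)) →
        ∣ zeroDifferences additiveGroup indexGroup (cosetIndex G h) a ∣ ≡
        n ∸ ∣ ⟦ (λ (x : ℤₙ) → d ∣? toℕ x) ⟧ ∣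
      ∣zeroDifferences∣ a d criterion = ∣⟦⟧∣-complement (unmoved? a) (λ x → d ∣? toℕ x) (λ x → mk⇔
        (Equivalence.to (criterion (toℕ x)) ∘ Equivalence.to (cosetIndex-shift x a))
        (Equivalence.from (cosetIndex-shift x a) ∘ Equivalence.from (criterion (toℕ x))))

-- The parameters of the coset index function.

theorem3p7 : (s p k : ℕ) → s ≥ 1 → (pr : Prime p) → (k≥2s : k ≥ 2 * s) →
    let open ℤMod (p ^ k) {{prime^-nonZero pr k}}
        G = ⟨ [ p ^ (k ∸ s) + 1 ] , p^[k∸s]+1-isUnit s p k pr k≥2s ⟩
    in
    (h : Bijection (D G) (setoid (Fin (∣D∣ G)))) →
    IsZeroDifference
      additiveGroup
      (ℤ/ (∣D∣ G) (∣D∣-nonZero (p ^ k) {{prime^-nonZero pr k}} G))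
      (p ^ k)
      ((s * p + p ∸ s) * p ^ (k ∸ s ∸ 1))
      (⋃[ i ∶ Fin s ] (｛ 0 ｝ ∪ ｛ sum (map (λ j → φ (p ^ (k ∸ j))) (upTo (suc (toℕ i)))) ｝))
      (cosetIndex G h)
theorem3p7 s p k s≥1 pr k≥2s h = record
  { domain-size     = refl
  ; image-size      = trans (∣image∣≡∣D∣ unit h) (trans (∣D∣≡length unit T) ∣T∣)
  ; zero-difference = differences
  }
  where
  instance
    p≢0 : NonZero p
    p≢0 = prime⇒nonZero pr
    n≢0 : NonZero (p ^ k)
    n≢0 = m^n≢0 p k
    q≢0 : NonZero (p ^ (k ∸ s))
    q≢0 = m^n≢0 p (k ∸ s)
    p^s≢0 : NonZero (p ^ s)
    p^s≢0 = m^n≢0 p s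
  unit = p^[k∸s]+1-isUnit s p k pr k≥2s
  s+s≤k : s + s ≤ k
  s+s≤k = subst (λ α → s + α ≤ k) (+-identityʳ s) k≥2s
  s≤k : s ≤ k
  s≤k = m+n≤o⇒m≤o s s+s≤k
  s≤k∸s : s ≤ k ∸ s
  s≤k∸s = m+n≤o⇒m≤o∸n s s+s≤k
  n≡qp^s : p ^ k ≡ p ^ (k ∸ s) * p ^ s
  n≡qp^s = trans (cong (p ^_) (sym (m∸n+n≡m s≤k))) (^-distribˡ-+-* p (k ∸ s) s)
  -- Since `s ≤ k ∸ s`, one factor `q` contains `p ^ s`, which completes the other `q` to `p ^ k`.
  q² : p ^ (k ∸ s) * p ^ (k ∸ s) ≡ p ^ (k ∸ s ∸ s) * p ^ k
  q² = begin
    p ^ (k ∸ s) * p ^ (k ∸ s)                  ≡⟨ cong (λ α → p ^ α * p ^ (k ∸ s)) (m∸n+n≡m s≤k∸s) ⟨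
    p ^ (k ∸ s ∸ s + s) * p ^ (k ∸ s)          ≡⟨ cong (_* p ^ (k ∸ s)) (^-distribˡ-+-* p (k ∸ s ∸ s) s) ⟩
    p ^ (k ∸ s ∸ s) * p ^ s * p ^ (k ∸ s)      ≡⟨ *-assoc (p ^ (k ∸ s ∸ s)) (p ^ s) (p ^ (k ∸ s)) ⟩
    p ^ (k ∸ s ∸ s) * (p ^ s * p ^ (k ∸ s))    ≡⟨ cong (p ^ (k ∸ s ∸ s) *_) (trans (*-comm (p ^ s) _) (sym n≡qp^s)) ⟩
    p ^ (k ∸ s ∸ s) * p ^ k                    ∎
    where open ≡-Reasoning
  open Cosets (p ^ k) (p ^ (k ∸ s)) (p ^ (k ∸ s ∸ s)) (p ^ s) q² n≡qp^s
  open ℤMod (p ^ k) using (0ₙ; ℤₙ; additiveGroup; cosetIndex)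
  -- `transversal` takes the predecessor of the exponent of `q`; `k ∸ s ≥ s ≥ 1` makes the
  -- subtraction of `1` exact.
  reps = transversal pr (k ∸ s ∸ 1) s
  ∣T∣ : length (proj₁ reps) ≡ (s * p + p ∸ s) * p ^ (k ∸ s ∸ 1)
  ∣T∣ = proj₂ (proj₂ reps)
  T : Transversal (p ^ (k ∸ s)) (p ^ k) (proj₁ reps)
  T = subst (λ N → Transversal (p ^ (k ∸ s)) N (proj₁ reps)) (sym n≡qp^s)
    (subst (λ m → Transversal (p ^ m) (p ^ m * p ^ s) (proj₁ reps))
      (m+[n∸m]≡n (≤-trans s≥1 s≤k∸s)) (proj₁ (proj₂ reps)))
  -- The bound is exclusive, so the sum over `j` from `0` to `i` is `∑φ (suc i)`.
  ∑φ : ℕ → ℕ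
  ∑φ i = sum (map (λ j → φ (p ^ (k ∸ j))) (upTo i))
  ∑φ≡ : ∀ i → i ≤ k → ∑φ i ≡ p ^ k ∸ p ^ (k ∸ i)
  ∑φ≡ i i≤k = begin
    ∑φ i                                   ≡⟨ m+n∸n≡m (∑φ i) (p ^ (k ∸ i)) ⟨
    ∑φ i + p ^ (k ∸ i) ∸ p ^ (k ∸ i)       ≡⟨ cong (λ α → sum α + p ^ (k ∸ i) ∸ p ^ (k ∸ i))
                                                (List.map-upTo (λ j → φ (p ^ (k ∸ j))) i) ⟩
    sum (applyUpTo (λ j → φ (p ^ (k ∸ j))) i) + p ^ (k ∸ i) ∸ p ^ (k ∸ i)
                                           ≡⟨ cong (_∸ p ^ (k ∸ i)) (∑φ-prime-^ pr i k i≤k) ⟩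
    p ^ k ∸ p ^ (k ∸ i)                    ∎
    where open ≡-Reasoning
  differences : ∀ a → ¬ a ≡ 0ₙ → ∣ zeroDifferences additiveGroup (indexGroup unit) (cosetIndex (G unit) h) a ∣ ∈ᵤ
    (⋃[ i ∶ Fin s ] (｛ 0 ｝ ∪ ｛ ∑φ (suc (toℕ i)) ｝))
  differences a a≢0 = dichotomy (shift-criterion pr s (toℕ a)
    (λ toℕa≡0 → a≢0 (toℕ-≋-injective (≋-trans (≋-reflexive toℕa≡0) (≋-sym (toℕ-[] 0)))))
    (subst (toℕ a <_) n≡qp^s (Fin.toℕ<n a)))
    where
    dichotomy :
      (∀ x → ¬ x ~ (x + toℕ a) [ p ^ (k ∸ s) , p ^ (k ∸ s) * p ^ s ]) ⊎
      (∃[ i ] i < s × ∀ x → x ~ (x + toℕ a) [ p ^ (k ∸ s) , p ^ (k ∸ s) * p ^ s ] ⇔ (¬ p ^ suc i ∣ x)) →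
      ∣ zeroDifferences additiveGroup (indexGroup unit) (cosetIndex (G unit) h) a ∣ ∈ᵤ
        (⋃[ i ∶ Fin s ] (｛ 0 ｝ ∪ ｛ ∑φ (suc (toℕ i)) ｝))
    -- Every member of the union contains `0`; index `0` is chosen, and `s ≥ 1` provides it.
    dichotomy (inj₁ never) = fromℕ< s≥1 , inj₁ (sym (zeroDifferences-empty unit h a
      (subst (λ N → ∀ x → ¬ x ~ (x + toℕ a) [ p ^ (k ∸ s) , N ]) (sym n≡qp^s) never)))
    dichotomy (inj₂ (i , i<s , criterion)) = fromℕ< i<s , inj₂ (begin
        ∑φ (suc (toℕ (fromℕ< i<s)))    ≡⟨ cong (∑φ ∘ suc) (Fin.toℕ-fromℕ< i<s) ⟩
        ∑φ (suc i)                     ≡⟨ ∑φ≡ (suc i) i<k ⟩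
        p ^ k ∸ p ^ (k ∸ suc i)        ≡⟨ cong (p ^ k ∸_) (∣multiples-^∣ 0 (suc i) k z≤n i<k) ⟨
        p ^ k ∸ ∣ ⟦ (λ (x : ℤₙ) → p ^ suc i ∣? toℕ x) ⟧ ∣
                                       ≡⟨ ∣zeroDifferences∣ unit h a (p ^ suc i)
                                            (subst (λ N → ∀ x → x ~ (x + toℕ a) [ p ^ (k ∸ s) , N ] ⇔ (¬ p ^ suc i ∣ x))
                                              (sym n≡qp^s) criterion) ⟨
        ∣ zeroDifferences additiveGroup (indexGroup unit) (cosetIndex (G unit) h) a ∣ ∎)
      where
      open ≡-Reasoning
      i<k : i < k
      i<k = ≤-trans i<s s≤k
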